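{- Let $G$ be a nontrivial connected graph. Then $pvc(G)=2$ if and only if $diam(G)\geq 3$.
   Context: All graphs are simple, finite and undirected; nontrivial means having at least two vertices. Vertex-colorings are arbitrary (adjacent vertices may receive the same color). A path in a vertex-colored graph is a vertex-proper path if any two adjacent internal vertices of the path differ in color (the end-vertices of the path are not internal). A vertex-colored graph is proper vertex-connected if any two distinct vertices are joined by a vertex-proper path. For a connected graph $G$, $pvc(G)$ is the smallest number of colors required to make $G$ proper vertex-connected. The value $0$ is allowed: $pvc(G)=0$ means that no vertex needs to be colored, where an uncolored path counts as vertex-proper exactly when it has no internal vertices. $diam(G)$ is the maximum distance between two vertices of $G$. -}

module Defs where

open import Data.Fin using (Fin)
open import Data.List using (List; []; _∷_; [_]; _++_; drop; length)
open import Data.List.Relation.Unary.Linked using (Linked)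
open import Data.List.Relation.Unary.Unique.Propositional using (Unique)
open import Data.Nat using (ℕ; zero; suc; _≤_; _≥_)
open import Data.Product using (Σ; ∃; ∃₂; _×_)
open import Level using (0ℓ)
open import Relation.Binary.Construct.Closure.ReflexiveTransitive using (Star; ε; _◅_)
open import Relation.Binary.Core using (Rel)
open import Relation.Binary.Definitions using (Decidable; Irreflexive; Symmetric)
open import Relation.Binary.PropositionalEquality using (_≡_; _≢_)

IsLeast : (ℕ → Set) → ℕ → Set
IsLeast P m = P m × (∀ k → P k → m ≤ k)

IsGreatest : (ℕ → Set) → ℕ → Set
IsGreatest P m = P m × (∀ k → P k → k ≤ m)

-- Finite simple graphs, with vertex set Fin n.  Adjacency is decidable, as it
-- always is classically, so that finite searches are constructive.
record Graph (n : ℕ) : Set₁ where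
  infix 4 _~_ _~?_
  field
    _~_    : Rel (Fin n) 0ℓ
    _~?_   : Decidable _~_
    sym    : Symmetric _~_
    irrefl : Irreflexive _≡_ _~_

module _ {n : ℕ} (G : Graph n) where
  open Graph G using (_~_)

  Walk : Rel (Fin n) 0ℓ
  Walk = Star _~_

  -- All vertices visited, in order, except the last one.
  initial : ∀ {u v} → Walk u v → List (Fin n)
  initial ε             = []
  initial {u} (_ ◅ w)   = u ∷ initial w

  vertices : ∀ {u v} → Walk u v → List (Fin n)
  vertices {v = v} w = initial w ++ [ v ]

  record Path (u v : Fin n) : Set where
    constructor path
    field
      walk   : Walk u v
      unique : Unique (vertices walk)

  -- The number of edges, which is one less than the number of vertices.
  pathLength : ∀ {u v} → Path u v → ℕ
  pathLength p = length (initial (Path.walk p))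

  internal : ∀ {u v} → Path u v → List (Fin n)
  internal p = drop 1 (initial (Path.walk p))

  Connected : Set
  Connected = ∀ u v → Path u v

  IsDistance : Fin n → Fin n → ℕ → Set
  IsDistance u v = IsLeast (λ d → Σ (Path u v) λ p → pathLength p ≡ d)

  IsDiameter : ℕ → Set
  IsDiameter = IsGreatest (λ d → ∃₂ λ u v → IsDistance u v d)

  Diameter≥ : ℕ → Set
  Diameter≥ k = ∃ λ d → IsDiameter d × d ≥ k

  -- Adjacency of internal vertices is adjacency along the path, not in G.
  VertexProper : ∀ {k} → (Fin n → Fin k) → ∀ {u v} → Path u v → Set
  VertexProper c p = Linked (λ x y → c x ≢ c y) (internal p)

  ProperVertexConnected : ∀ {k} → (Fin n → Fin k) → Set
  ProperVertexConnected c = ∀ u v → u ≢ v → Σ (Path u v) (VertexProper c)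

  -- With no colors every vertex stays uncolored, and an uncolored path is
  -- vertex-proper exactly when it has no internal vertices.  A coloring in
  -- Fin k need not use all k colors; this does not affect the least k.
  ProperVertexConnectableWith : ℕ → Set
  ProperVertexConnectableWith zero    = ∀ u v → u ≢ v → Σ (Path u v) λ p → internal p ≡ []
  ProperVertexConnectableWith (suc k) = ∃ λ (c : Fin n → Fin (suc k)) → ProperVertexConnected c

  IsPvc : ℕ → Set
  IsPvc = IsLeast ProperVertexConnectableWith

{-# OPTIONS --safe #-}
module Submission where

-- If G has diameter at most 2, then shortest paths have at most one internal
-- vertex, so a single color suffices; conversely a proper path with at most one
-- color has length at most 2, so two vertices at distance at least 3 force two colors.
--
-- Two colors always suffice: color each vertex by the parity of its distance to
-- a root r.  The edges whose ends differ in color form a subgraph that contains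
-- every shortest path to r, hence is connected, and each of its paths is proper.

open import Data.Empty using (⊥-elim)
open import Data.Fin using (Fin; zero; suc; opposite; fromℕ<)
open import Data.Fin.Properties using (_≟_; any?)
open import Data.List using ([]; _∷_; _++_; length; drop; allFin; cartesianProduct)
open import Data.List.Extrema.Nat using (argmax; f[xs]≤f[argmax])
open import Data.List.Membership.Propositional using (_∈_)
open import Data.List.Membership.Propositional.Properties using (∈-allFin; ∈-cartesianProduct⁺)
open import Data.List.Relation.Unary.All using ([]; lookup)
open import Data.List.Relation.Unary.All.Properties using (¬Any⇒All¬)
open import Data.List.Relation.Unary.AllPairs using ([]; _∷_)
open import Data.List.Relation.Unary.Any using (here; there)
open import Data.List.Relation.Unary.Linked as Linked using (Linked; []; [-]; _∷_)
open import Data.List.Relation.Unary.Unique.Propositional using (Unique)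
open import Data.Nat using (ℕ; zero; suc; _≤_; _≥_; z≤n; s≤s; s≤s⁻¹; _≤?_)
open import Data.Nat.Properties using (≤-refl; ≤-reflexive; ≤-trans; ≤-antisym; m≤n⇒m≤1+n; ≰⇒>; suc-injective)
open import Data.Product using (Σ; ∃; _×_; _,_; proj₁; proj₂; uncurry)
open import Function.Bundles using (_⇔_; mk⇔)
open import Relation.Binary.Construct.Closure.ReflexiveTransitive as Star using (ε; _◅_; _◅◅_)
open import Relation.Binary.PropositionalEquality using (_≡_; _≢_; refl; sym; cong; subst; subst₂; ≢-sym)
open import Relation.Nullary using (¬_; Dec; yes; no; ¬?; contradiction)
open import Relation.Nullary.Decidable using (map′; _×-dec_)
open import Defs

-- The known witness `m` bounds the search: each failed test at zero shifts the predicate by one and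
-- lowers `m`.
least : ∀ {P : ℕ → Set} → (∀ k → Dec (P k)) → ∀ m → P m → ∃ (IsLeast P)
least P? zero p = zero , p , λ _ _ → z≤n
least P? (suc m) p with P? zero
... | yes p₀ = zero , p₀ , λ _ _ → z≤n
... | no ¬p₀ with least (λ k → P? (suc k)) m p
...   | k , pk , k≤ = suc k , pk , λ where
          zero    p₀ → contradiction p₀ ¬p₀
          (suc j) pj → s≤s (k≤ j pj)

IsLeast-unique : ∀ {P : ℕ → Set} {k l} → IsLeast P k → IsLeast P l → k ≡ l
IsLeast-unique (pk , k≤) (pl , l≤) = ≤-antisym (k≤ _ pl) (l≤ _ pk)

module _ {n : ℕ} (G : Graph n) where
  open Graph G using (_~_; _~?_)
  open import Data.List.Membership.DecPropositional (_≟_ {n}) using (_∈?_)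

  walkLength : ∀ {u v} → Walk G u v → ℕ
  walkLength w = length (initial G w)

  -- Walks rather than paths: the tail of a walk is an arbitrary walk, with no distinctness
  -- condition to carry, so existence is decidable by recursion on the length.
  HasWalk : Fin n → Fin n → ℕ → Set
  HasWalk u v k = Σ (Walk G u v) λ w → walkLength w ≡ k

  hasWalk? : ∀ u v k → Dec (HasWalk u v k)
  hasWalk? u v zero = map′ (λ { refl → ε , refl }) (λ { (ε , _) → refl }) (u ≟ v)
  hasWalk? u v (suc k) = map′
    (λ { (_ , e , w , eq) → e ◅ w , cong suc eq })
    (λ { (e ◅ w , eq) → _ , e , w , suc-injective eq })
    (any? λ x → (u ~? x) ×-dec hasWalk? x v k)

  suffixFrom : ∀ {u v x} (w : Walk G u v) → Unique (vertices G w) → x ∈ vertices G w →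
               Σ (Path G x v) λ p → pathLength G p ≤ walkLength w
  suffixFrom ε       uq       (here refl) = path ε uq , z≤n
  suffixFrom (e ◅ w) uq       (here refl) = path (e ◅ w) uq , ≤-refl
  suffixFrom (e ◅ w) (_ ∷ uq) (there x∈w) with suffixFrom w uq x∈w
  ... | p , p≤w = p , m≤n⇒m≤1+n p≤w

  loopErase : ∀ {u v} (w : Walk G u v) → Σ (Path G u v) λ p → pathLength G p ≤ walkLength w
  loopErase ε = path ε ([] ∷ []) , z≤n
  loopErase {u} (e ◅ w) with loopErase w
  ... | path w′ uq , w′≤w with u ∈? vertices G w′
  -- The walk returns to `u`: cut out the loop by keeping only what follows that visit.
  ...   | yes u∈w′ = let p , p≤w′ = suffixFrom w′ uq u∈w′ in p , m≤n⇒m≤1+n (≤-trans p≤w′ w′≤w)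
  ...   | no  u∉w′ = path (e ◅ w′) (¬Any⇒All¬ _ u∉w′ ∷ uq) , s≤s w′≤w

  -- Loop erasure never lengthens a walk, and every path is a walk, so both minima agree.
  leastWalk⇒distance : ∀ {u v d} → IsLeast (HasWalk u v) d → IsDistance G u v d
  leastWalk⇒distance ((w , refl) , w≤) with loopErase w
  ... | p , p≤w = (p , ≤-antisym p≤w (w≤ _ (Path.walk p , refl)))
                , λ k (q , eq) → w≤ k (Path.walk q , eq)

  pathLength≤1+internal : ∀ {u v} (p : Path G u v) → pathLength G p ≤ suc (length (internal G p))
  pathLength≤1+internal (path ε       _) = z≤n
  pathLength≤1+internal (path (_ ◅ _) _) = ≤-refl

  module _ (connected : Connected G) where

    leastWalk : ∀ u v → ∃ (IsLeast (HasWalk u v))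
    leastWalk u v = least (hasWalk? u v) _ (Path.walk (connected u v) , refl)

    dist : Fin n → Fin n → ℕ
    dist u v = proj₁ (leastWalk u v)

    dist-isDistance : ∀ u v → IsDistance G u v (dist u v)
    dist-isDistance u v = leastWalk⇒distance (proj₂ (leastWalk u v))

    diameter : Fin n → Σ (Fin n × Fin n) λ (a , b) → ∀ u v → dist u v ≤ dist a b
    -- The pair `(r , r)` is the default value that `argmax` requires.
    diameter r = ab , λ u v → lookup (f[xs]≤f[argmax] (r , r) pairs)
                                     (∈-cartesianProduct⁺ (∈-allFin u) (∈-allFin v))
      where
      pairs = cartesianProduct (allFin n) (allFin n)
      ab    = argmax (uncurry dist) (r , r) pairs

bichromatic : ∀ {n k} → Graph n → (Fin n → Fin k) → Graph n
bichromatic G c = record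
  { _~_    = λ x y → x ~ y × c x ≢ c y
  ; _~?_   = λ x y → (x ~? y) ×-dec ¬? (c x ≟ c y)
  ; sym    = λ (e , c≢) → ~-sym e , ≢-sym c≢
  ; irrefl = λ eq (e , _) → irrefl eq e
  }
  where open Graph G renaming (sym to ~-sym)

module _ {n k : ℕ} (G : Graph n) (c : Fin n → Fin k) where
  private H = bichromatic G c

  forget : ∀ {u v} → Walk H u v → Walk G u v
  forget = Star.map proj₁

  initial-forget : ∀ {u v} (w : Walk H u v) → initial G (forget w) ≡ initial H w
  initial-forget ε       = refl
  initial-forget (e ◅ w) = cong (_ ∷_) (initial-forget w)

  initial-alternates : ∀ {u v} (w : Walk H u v) → Linked (λ x y → c x ≢ c y) (initial H w)
  initial-alternates ε                  = []
  initial-alternates (_ ◅ ε)            = [-]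
  initial-alternates ((_ , c≢) ◅ e ◅ w) = c≢ ∷ initial-alternates (e ◅ w)

  drop1⁺ : ∀ {R : Fin n → Fin n → Set} {xs} → Linked R xs → Linked R (drop 1 xs)
  drop1⁺ {xs = []}    _   = []
  drop1⁺ {xs = _ ∷ _} Rxs = Linked.tail Rxs

  -- Loops are erased inside `H`, so the resulting path still has only bichromatic edges; forgetting
  -- the colors leaves its vertex list unchanged.
  bichromatic-proper : ∀ {u v} → Walk H u v → Σ (Path G u v) (VertexProper G c)
  bichromatic-proper w with proj₁ (loopErase H w)
  ... | path w′ uq
      = path (forget w′) (subst (λ xs → Unique (xs ++ _)) (sym (initial-forget w′)) uq)
      , subst (λ xs → Linked (λ x y → c x ≢ c y) (drop 1 xs)) (sym (initial-forget w′))
              (drop1⁺ (initial-alternates w′))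

parity : ℕ → Fin 2
parity zero    = zero
parity (suc k) = opposite (parity k)

opposite≢ : (i : Fin 2) → opposite i ≢ i
opposite≢ zero       ()
opposite≢ (suc zero) ()

module _ {n : ℕ} (G : Graph n) (connected : Connected G) where

  depthColor : Fin n → Fin n → Fin 2
  depthColor r v = parity (dist G connected v r)

  -- Along a shortest walk to `r` the distance to `r` drops by exactly one per step, so the parity
  -- flips at every edge.
  walkToRoot : ∀ r k v → IsLeast (HasWalk G v r) k → Walk (bichromatic G (depthColor r)) v r
  walkToRoot r zero    v ((ε , _) , _) = ε
  walkToRoot r (suc k) v l@((_◅_ {j = x} e w , eq) , k≤)
    = (e , subst₂ (λ i j → parity i ≢ parity j) (depth l) (depth lₓ) (opposite≢ _)) ◅ walkToRoot r k x lₓ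
    where
    lₓ : IsLeast (HasWalk G x r) k
    -- A shorter walk from `x`, prefixed with `e`, would beat the shortest walk from `v`.
    lₓ = (w , suc-injective eq) , λ j (w′ , eq′) → s≤s⁻¹ (k≤ (suc j) (e ◅ w′ , cong suc eq′))
    depth : ∀ {y j} → IsLeast (HasWalk G y r) j → j ≡ dist G connected y r
    depth lʸ = IsLeast-unique lʸ (proj₂ (leastWalk G connected _ r))

  two-colors-suffice : Fin n → ProperVertexConnectableWith G 2
  two-colors-suffice r = depthColor r , λ u v _ →
    bichromatic-proper G (depthColor r) (toRoot u ◅◅ Star.reverse H.sym (toRoot v))
    where
    module H = Graph (bichromatic G (depthColor r))
    toRoot : ∀ v → Walk (bichromatic G (depthColor r)) v r
    toRoot v = walkToRoot r _ v (proj₂ (leastWalk G connected v r))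

module _ {A : Set} {R : A → A → Set} where

  length≤1⇒Linked : ∀ {xs} → length xs ≤ 1 → Linked R xs
  length≤1⇒Linked {[]}        _         = []
  length≤1⇒Linked {_ ∷ []}    _         = [-]
  length≤1⇒Linked {_ ∷ _ ∷ _} (s≤s ())

  Linked-empty⇒length≤1 : (∀ x y → ¬ R x y) → ∀ {xs} → Linked R xs → length xs ≤ 1
  Linked-empty⇒length≤1 ¬R []      = z≤n
  Linked-empty⇒length≤1 ¬R [-]     = ≤-refl
  Linked-empty⇒length≤1 ¬R (r ∷ _) = contradiction r (¬R _ _)

Fin1-≡ : (i j : Fin 1) → i ≡ j
Fin1-≡ zero zero = refl

module _ {n : ℕ} (G : Graph n) where

  distance≤2⇒one-color : (∀ u v → Σ (Path G u v) λ p → pathLength G p ≤ 2) →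
                         ProperVertexConnectableWith G 1
  distance≤2⇒one-color short = (λ _ → zero) , λ u v _ →
    let p , p≤2 = short u v in p , length≤1⇒Linked (internal≤1 p p≤2)
    where
    internal≤1 : ∀ {u v} (p : Path G u v) → pathLength G p ≤ 2 → length (internal G p) ≤ 1
    internal≤1 (path ε       _) _         = z≤n
    internal≤1 (path (_ ◅ _) _) (s≤s p≤1) = p≤1

  -- Every path from `u` to `v` has at least two internal vertices, whereas a proper path has none
  -- with no colors and at most one with a single color.
  distance≥3⇒two-colors : ∀ {u v d} → IsDistance G u v d → d ≥ 3 →
                          ∀ k → ProperVertexConnectableWith G k → 2 ≤ k
  distance≥3⇒two-colors {u} {v} (_ , d≤) d≥3 = λ where
      zero paths →
        let p , eq = paths u v u≢v in
        ⊥-elim (¬short p (≤-trans (≤-reflexive (cong length eq)) z≤n))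
      (suc zero) (c , paths) →
        let p , proper = paths u v u≢v in
        ⊥-elim (¬short p (Linked-empty⇒length≤1 (λ x y c≢ → c≢ (Fin1-≡ (c x) (c y))) proper))
      (suc (suc _)) _ → s≤s (s≤s z≤n)
    where
    ¬short : (p : Path G u v) → ¬ (length (internal G p) ≤ 1)
    ¬short p i≤1 with ≤-trans d≥3 (≤-trans (d≤ _ (p , refl)) (≤-trans (pathLength≤1+internal G p) (s≤s i≤1)))
    ... | s≤s (s≤s ())
    u≢v : u ≢ v
    -- If `u` and `v` coincided, the trivial path would be too short.
    u≢v refl = ¬short (path ε ([] ∷ [])) z≤n

theorem1 : ∀ (n : ℕ) (G : Graph n) → n ≥ 2 → Connected G → IsPvc G 2 ⇔ Diameter≥ G 3
theorem1 n G n≥2 connected = mk⇔ to from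
  where
  r : Fin n
  r = fromℕ< (≤-trans (s≤s z≤n) n≥2)

  to : IsPvc G 2 → Diameter≥ G 3
  to (_ , 2≤) with diameter G connected r
  ... | (a , b) , dist≤ with 3 ≤? dist G connected a b
  ...   | yes 3≤D = dist G connected a b
                  , ((a , b , dist-isDistance G connected a b) , λ k (u , v , duv) →
                      -- Any distance `k` between `u` and `v` equals `dist u v`, to which the
                      -- maximum applies.
                      subst (_≤ _) (IsLeast-unique (dist-isDistance G connected u v) duv) (dist≤ u v))
                  , 3≤D
  -- All distances are now at most 2, so one color suffices, against the minimality of 2.
  ...   | no 3≰D with 2≤ 1 (distance≤2⇒one-color G λ u v →
                     let (p , eq) , _ = dist-isDistance G connected u v in
                     p , ≤-trans (≤-reflexive eq) (≤-trans (dist≤ u v) (s≤s⁻¹ (≰⇒> 3≰D))))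
  ...     | s≤s ()

  from : Diameter≥ G 3 → IsPvc G 2
  from (_ , ((_ , _ , duv) , _) , d≥3) =
    two-colors-suffice G connected r , distance≥3⇒two-colors G duv d≥3
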